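{- Let $G$ be a finite simple graph, let $v\in V(G)$ and let $B\subseteq V(G)$. Then: (i) if $v\in B$, then $$C_B(G;x)=C_{B\setminus\{v\}}(G-v;x)+x\,C_{B\cap N(v)}(G[N(v)];x);$$ (ii) if $v\notin B$, then $$C_B(G;x)=C_B(G-v;x).$$
   Context: For a finite simple graph $G$ and a subset $B\subseteq V(G)$, the $B$-restricted clique polynomial is $C_B(G;x)=\sum_{i=0}^{\omega(G[B])} c_i(B)x^i$, where $c_i(B)$ is the number of subsets $K\subseteq B$ with $|K|=i$ that are cliques in $G$ (pairwise adjacent vertices); the empty set counts as a clique, so $c_0(B)=1$. Here $G[S]$ is the subgraph of $G$ induced by $S$, $\omega$ is the clique number, $N(v)$ is the (open) neighbourhood of $v$ in $G$, and $G-v$ is the graph obtained by deleting the vertex $v$. -}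

module Defs where

open import Level using (0ℓ)
open import Data.Fin using (Fin)
open import Data.Fin.Properties using (all?) renaming (_≟_ to _≟ᶠ_)
open import Data.Fin.Subset using (Subset; inside; outside; _∈_; _⊆_; _∩_; _-_; ∣_∣)
open import Data.Fin.Subset.Properties using (_∈?_; _⊆?_; x∈p∩q⁺)
open import Data.List using (List; []; _∷_; _++_; map; filter; length; applyUpTo)
open import Data.List.Extrema.Nat using (max)
open import Data.Nat using (ℕ; zero; suc; _+_; _*_; _≟_)
open import Data.Product using (_×_; _,_)
open import Data.Vec using ([]; _∷_; tabulate)
open import Relation.Binary.Core using (Rel)
open import Relation.Binary.Definitions using (Decidable; Symmetric)
open import Relation.Binary.PropositionalEquality using (_≡_; _≢_)
open import Relation.Nullary using (¬_; Dec; does; ¬?; _×-dec_; _→-dec_)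

-- Vertices are drawn from an ambient label set Fin n, with the vertex set V
-- an arbitrary subset of it.  Thus G, G - v and G[S] are graphs on the same
-- labels, and a subset of V(G - v) or V(G[S]) is literally a subset of V(G).
-- Decidable adjacency is part of the data: constructively it is what makes
-- the cliques of a finite graph countable.
record Graph (n : ℕ) : Set₁ where
  field
    V           : Subset n
    Adj         : Rel (Fin n) 0ℓ
    Adj?        : Decidable Adj
    symmetric   : Symmetric Adj
    irreflexive : ∀ {u} → ¬ Adj u u
    Adj⇒∈V      : ∀ {u w} → Adj u w → u ∈ V

open Graph public

N : ∀ {n} → Graph n → Fin n → Subset n
N G v = tabulate (λ u → does (Adj? G v u))

-- The vertex set is V G ∩ S, which is S whenever S ⊆ V G.
infix 8 _[_]
_[_] : ∀ {n} → Graph n → Subset n → Graph n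
G [ S ] = record
  { V           = V G ∩ S
  ; Adj         = λ u w → u ∈ S × w ∈ S × Adj G u w
  ; Adj?        = λ u w → (u ∈? S) ×-dec (w ∈? S) ×-dec Adj? G u w
  ; symmetric   = λ (u∈S , w∈S , uw) → w∈S , u∈S , symmetric G uw
  ; irreflexive = λ (_ , _ , uu) → irreflexive G uu
  ; Adj⇒∈V      = λ (u∈S , _ , uw) → x∈p∩q⁺ (Adj⇒∈V G uw , u∈S)
  }

infixl 8 _∖ᵛ_
_∖ᵛ_ : ∀ {n} → Graph n → Fin n → Graph n
G ∖ᵛ v = G [ V G - v ]

IsClique : ∀ {n} → Graph n → Subset n → Set
IsClique G K = K ⊆ V G × (∀ u w → u ∈ K → w ∈ K → u ≢ w → Adj G u w)

isClique? : ∀ {n} (G : Graph n) (K : Subset n) → Dec (IsClique G K)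
isClique? G K = (K ⊆? V G) ×-dec
  all? (λ u → all? (λ w →
    (u ∈? K) →-dec ((w ∈? K) →-dec (¬? (u ≟ᶠ w) →-dec Adj? G u w))))

-- Every subset of Fin n occurs in this list exactly once.
subsets : ∀ n → List (Subset n)
subsets zero    = [] ∷ []
subsets (suc n) = map (inside ∷_) (subsets n) ++ map (outside ∷_) (subsets n)

ω : ∀ {n} → Graph n → ℕ
ω {n} G = max 0 (map ∣_∣ (filter (isClique? G) (subsets n)))

cliqueCount : ∀ {n} → Graph n → Subset n → ℕ → ℕ
cliqueCount {n} G B i =
  length (filter (λ K → (K ⊆? B) ×-dec (∣ K ∣ ≟ i) ×-dec isClique? G K) (subsets n))

-- Formal polynomials in one variable over ℕ: the list a₀ ∷ a₁ ∷ … ∷ a_d ∷ []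
-- stands for a₀ + a₁ x + … + a_d x^d.  Trailing zeros are allowed, so equality
-- of polynomials is _≈ₚ_, not _≡_.
Poly : Set
Poly = List ℕ

coeff : Poly → ℕ → ℕ
coeff []      _       = 0
coeff (a ∷ _) zero    = a
coeff (_ ∷ p) (suc i) = coeff p i

infix 4 _≈ₚ_
_≈ₚ_ : Poly → Poly → Set
p ≈ₚ q = ∀ i → coeff p i ≡ coeff q i

infixl 6 _+ₚ_
_+ₚ_ : Poly → Poly → Poly
[]      +ₚ q       = q
(a ∷ p) +ₚ []      = a ∷ p
(a ∷ p) +ₚ (b ∷ q) = (a + b) ∷ (p +ₚ q)

infixl 7 _*ₚ_
_*ₚ_ : Poly → Poly → Poly
[]      *ₚ q = []
(a ∷ p) *ₚ q = map (a *_) q +ₚ (0 ∷ (p *ₚ q))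

X : Poly
X = 0 ∷ 1 ∷ []

-- The coefficient list c₀(B), …, c_ω(B) with ω = ω(G[B]).
cliquePoly : ∀ {n} → Subset n → Graph n → Poly
cliquePoly B G = applyUpTo (cliqueCount G B) (suc (ω (G [ B ])))

{-# OPTIONS --safe #-}
module Submission where

-- Beyond degree ω(G[B]) there are no cliques inside B, so every coefficient of
-- C_B(G; x), not just the listed ones, is a clique count.  Cliques avoiding v
-- are the cliques of G - v, and K ↦ K ∪ {v} is a bijection from the cliques of
-- G[N(v)] onto the cliques of G containing v, raising the size by one.

open import Defs
open import Algebra.Properties.CommutativeSemigroup using (interchange)
open import Data.Bool using (true; false)
open import Data.Fin using (Fin; zero; suc)
open import Data.Fin.Subset using (Subset; inside; outside; _∈_; _∉_; _⊆_; _∩_; _-_; ∣_∣)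
open import Data.Fin.Subset.Properties using (_⊆?_; drop-there; x∈p∩q⁺; p∩q⊆p; p∩q⊆q; p─q⊆p; x∈p∧x≢y⇒x∈p-y; x∈p⇒∣p-x∣<∣p∣)
open import Data.List using (List; []; _∷_; _++_; map; filter; length; applyUpTo)
open import Data.List.Extrema.Nat using (xs≤max)
open import Data.List.Membership.Propositional using () renaming (_∈_ to _∈ˡ_)
open import Data.List.Membership.Propositional.Properties using (∈-map⁺; ∈-++⁺ˡ; ∈-++⁺ʳ; ∈-filter⁺)
open import Data.List.Properties using (filter-≐; filter-none; filter-++; length-++)
open import Data.List.Relation.Unary.Any as Any using ()
open import Data.List.Relation.Unary.All as All using ()
open import Data.Nat using (ℕ; zero; suc; _+_; _*_; _≤_; _<_; z≤n; s≤s; _≟_)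
open import Data.Nat.Properties using (+-identityʳ; +-comm; +-commutativeSemigroup; *-identityˡ; *-zeroʳ; n≮0; suc-injective; ≤⇒≯)
open import Data.Product using (_×_; _,_; proj₁; proj₂)
open import Data.Sum as Sum using (_⊎_; inj₁; inj₂)
open import Data.Vec using ([]; _∷_; here; there; _[_]≔_)
open import Data.Vec.Properties using (lookup∘tabulate; lookup⇒[]=; []=⇒lookup; []≔-updates)
open import Function using (_∘_; _⇔_; mk⇔; Equivalence)
open import Level using (0ℓ)
open import Relation.Binary.PropositionalEquality using (_≡_; _≢_; refl; sym; trans; cong; cong₂; subst; module ≡-Reasoning)
open import Relation.Nullary using (¬_; yes; does; contradiction; _×-dec_)
open import Relation.Nullary.Decidable using (dec-true)
open import Relation.Unary using (Pred; Decidable)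

open Equivalence using (to; from)

private variable
  n : ℕ
  P Q R : Pred (Subset n) 0ℓ

-- Coefficients of polynomials.

coeff-+ₚ : ∀ p q i → coeff (p +ₚ q) i ≡ coeff p i + coeff q i
coeff-+ₚ []      q       i       = refl
coeff-+ₚ (a ∷ p) []      i       = sym (+-identityʳ _)
coeff-+ₚ (a ∷ p) (b ∷ q) zero    = refl
coeff-+ₚ (a ∷ p) (b ∷ q) (suc i) = coeff-+ₚ p q i

coeff-map-* : ∀ a p i → coeff (map (a *_) p) i ≡ a * coeff p i
coeff-map-* a []      i       = sym (*-zeroʳ a)
coeff-map-* a (b ∷ p) zero    = refl
coeff-map-* a (b ∷ p) (suc i) = coeff-map-* a p i

coeff-X*ₚ-zero : ∀ p → coeff (X *ₚ p) 0 ≡ 0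
coeff-X*ₚ-zero p = trans (coeff-+ₚ (map (0 *_) p) _ 0) (trans (+-identityʳ _) (coeff-map-* 0 p 0))

coeff-X*ₚ-suc : ∀ p i → coeff (X *ₚ p) (suc i) ≡ coeff p i
coeff-X*ₚ-suc p i = begin
  -- `X *ₚ p` unfolds to `map (0 *_) p +ₚ (0 ∷ (map (1 *_) p +ₚ (0 ∷ [])))`: only the middle summand
  -- matters, and its leading `0` shifts the index.
  coeff (X *ₚ p) (suc i)                                    ≡⟨ coeff-+ₚ (map (0 *_) p) _ (suc i) ⟩
  coeff (map (0 *_) p) (suc i) + coeff (map (1 *_) p +ₚ (0 ∷ [])) i
    ≡⟨ cong₂ _+_ (coeff-map-* 0 p (suc i)) (coeff-+ₚ (map (1 *_) p) (0 ∷ []) i) ⟩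
  coeff (map (1 *_) p) i + coeff (0 ∷ []) i                 ≡⟨ cong₂ _+_ (coeff-map-* 1 p i) (zeros i) ⟩
  1 * coeff p i + 0                                         ≡⟨ +-identityʳ _ ⟩
  1 * coeff p i                                             ≡⟨ *-identityˡ _ ⟩
  coeff p i                                                 ∎
  where
  open ≡-Reasoning
  zeros : ∀ i → coeff (0 ∷ []) i ≡ 0
  zeros zero    = refl
  zeros (suc i) = refl

-- Past the end of the list `coeff` defaults to 0, and the vanishing hypothesis makes `f` agree with
-- that default.
coeff-applyUpTo : ∀ f m → (∀ i → m ≤ i → f i ≡ 0) → ∀ i → coeff (applyUpTo f m) i ≡ f i
coeff-applyUpTo f zero    f≡0 i       = sym (f≡0 i z≤n)
coeff-applyUpTo f (suc m) f≡0 zero    = refl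
coeff-applyUpTo f (suc m) f≡0 (suc i) =
  coeff-applyUpTo (f ∘ suc) m (λ j m≤j → f≡0 (suc j) (s≤s m≤j)) i

-- Counting subsets that satisfy a predicate.

∈-subsets : (K : Subset n) → K ∈ˡ subsets n
∈-subsets []            = Any.here refl
∈-subsets (inside ∷ K)  = ∈-++⁺ˡ (∈-map⁺ (inside ∷_) (∈-subsets K))
∈-subsets (outside ∷ K) = ∈-++⁺ʳ _ (∈-map⁺ (outside ∷_) (∈-subsets K))

count : {P : Pred (Subset n) 0ℓ} → Decidable P → ℕ
count {n} P? = length (filter P? (subsets n))

count-cong : (P? : Decidable P) (Q? : Decidable Q) → (∀ {K} → P K ⇔ Q K) → count P? ≡ count Q?
count-cong P? Q? P⇔Q = cong length (filter-≐ P? Q? (to P⇔Q , from P⇔Q) (subsets _))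

count-none : (P? : Decidable P) → (∀ {K} → ¬ P K) → count P? ≡ 0
count-none P? ¬P = cong length (filter-none P? (All.universal (λ _ → ¬P) (subsets _)))

length-filter-map : {A B : Set} {P : Pred B 0ℓ} (P? : Decidable P) (f : A → B) (xs : List A) →
  length (filter P? (map f xs)) ≡ length (filter (P? ∘ f) xs)
length-filter-map P? f []       = refl
length-filter-map P? f (x ∷ xs) with does (P? (f x))
... | true  = cong suc (length-filter-map P? f xs)
... | false = length-filter-map P? f xs

count-∷ : {P : Pred (Subset (suc n)) 0ℓ} (P? : Decidable P) →
  count P? ≡ count (P? ∘ (inside ∷_)) + count (P? ∘ (outside ∷_))
count-∷ {n} P? = begin
  count P?                                          ≡⟨ cong length (filter-++ P? (map (inside ∷_) (subsets n)) _) ⟩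
  length (filter P? (map (inside ∷_) (subsets n)) ++ filter P? (map (outside ∷_) (subsets n)))
    ≡⟨ length-++ (filter P? (map (inside ∷_) (subsets n))) ⟩
  length (filter P? (map (inside ∷_) (subsets n))) + length (filter P? (map (outside ∷_) (subsets n)))
    ≡⟨ cong₂ _+_ (length-filter-map P? (inside ∷_) (subsets n)) (length-filter-map P? (outside ∷_) (subsets n)) ⟩
  count (P? ∘ (inside ∷_)) + count (P? ∘ (outside ∷_)) ∎
  where open ≡-Reasoning

-- Sorts the subsets K by whether v ∈ K; those containing v are L ∪ {v} for a
-- unique L avoiding v.
count-split : (v : Fin n) (P? : Decidable P) (Q? : Decidable Q) (R? : Decidable R) →
  (∀ {K} → Q K → v ∉ K) → (∀ {K} → v ∉ K → P K ⇔ Q K) →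
  (∀ {K} → R K → v ∉ K) → (∀ {K} → v ∉ K → P (K [ v ]≔ inside) ⇔ R K) →
  count P? ≡ count Q? + count R?
count-split zero P? Q? R? Q⇒∉ P⇔Q R⇒∉ P⇔R = begin
  count P?                                                 ≡⟨ count-∷ P? ⟩
  count (P? ∘ (inside ∷_)) + count (P? ∘ (outside ∷_))     ≡⟨ +-comm (count (P? ∘ (inside ∷_))) _ ⟩
  count (P? ∘ (outside ∷_)) + count (P? ∘ (inside ∷_))
    -- Setting entry `zero` to `inside` turns `outside ∷ K` into `inside ∷ K`, so the `inside` half
    -- of `P` is matched with the `outside` half of `R`.
    ≡⟨ cong₂ _+_ (count-cong (P? ∘ (outside ∷_)) (Q? ∘ (outside ∷_)) (P⇔Q λ ()))
                 (count-cong (P? ∘ (inside ∷_)) (R? ∘ (outside ∷_)) (P⇔R λ ())) ⟩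
  count (Q? ∘ (outside ∷_)) + count (R? ∘ (outside ∷_))    ≡⟨ cong₂ _+_ (avoid Q? Q⇒∉) (avoid R? R⇒∉) ⟨
  count Q? + count R?                                      ∎
  where
  open ≡-Reasoning
  avoid : {S : Pred (Subset (suc _)) 0ℓ} (S? : Decidable S) → (∀ {K} → S K → zero ∉ K) →
    count S? ≡ count (S? ∘ (outside ∷_))
  avoid S? S⇒∉ = trans (count-∷ S?)
    (cong (_+ count (S? ∘ (outside ∷_))) (count-none (S? ∘ (inside ∷_)) (λ s → S⇒∉ s here)))
count-split (suc v) P? Q? R? Q⇒∉ P⇔Q R⇒∉ P⇔R = begin
  -- Here `v` points into the tail: each choice of first entry is split recursively, and
  -- `interchange` regroups the four counts.
  count P?                                                 ≡⟨ count-∷ P? ⟩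
  count (P? ∘ (inside ∷_)) + count (P? ∘ (outside ∷_))     ≡⟨ cong₂ _+_ (tail inside) (tail outside) ⟩
  (count (Q? ∘ (inside ∷_)) + count (R? ∘ (inside ∷_))) + (count (Q? ∘ (outside ∷_)) + count (R? ∘ (outside ∷_)))
    ≡⟨ interchange +-commutativeSemigroup (count (Q? ∘ (inside ∷_))) _ _ _ ⟩
  (count (Q? ∘ (inside ∷_)) + count (Q? ∘ (outside ∷_))) + (count (R? ∘ (inside ∷_)) + count (R? ∘ (outside ∷_)))
    ≡⟨ cong₂ _+_ (count-∷ Q?) (count-∷ R?) ⟨
  count Q? + count R?                                      ∎
  where
  open ≡-Reasoning
  tail : ∀ s → count (P? ∘ (s ∷_)) ≡ count (Q? ∘ (s ∷_)) + count (R? ∘ (s ∷_))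
  tail s = count-split v (P? ∘ (s ∷_)) (Q? ∘ (s ∷_)) (R? ∘ (s ∷_))
    (λ q → Q⇒∉ q ∘ there) (λ v∉K → P⇔Q (v∉K ∘ drop-there))
    (λ r → R⇒∉ r ∘ there) (λ v∉K → P⇔R (v∉K ∘ drop-there))

-- Adding a vertex to a subset and removing one.

∈-[]≔ : ∀ {x} (K : Subset n) v → x ∈ K [ v ]≔ inside → x ≡ v ⊎ x ∈ K
∈-[]≔ (s ∷ K) zero    here        = inj₁ refl
∈-[]≔ (s ∷ K) zero    (there x∈K) = inj₂ (there x∈K)
∈-[]≔ (s ∷ K) (suc v) here        = inj₂ here
∈-[]≔ (s ∷ K) (suc v) (there x∈)  = Sum.map (cong suc) there (∈-[]≔ K v x∈)

⊆-[]≔ : (K : Subset n) (v : Fin n) → K ⊆ K [ v ]≔ inside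
⊆-[]≔ (s ∷ K) zero    here        = here
⊆-[]≔ (s ∷ K) zero    (there x∈K) = there x∈K
⊆-[]≔ (s ∷ K) (suc v) here        = here
⊆-[]≔ (s ∷ K) (suc v) (there x∈K) = there (⊆-[]≔ K v x∈K)

∣[]≔∣ : (K : Subset n) (v : Fin n) → v ∉ K → ∣ K [ v ]≔ inside ∣ ≡ suc ∣ K ∣
∣[]≔∣ (inside ∷ K)  zero    v∉K = contradiction here v∉K
∣[]≔∣ (outside ∷ K) zero    v∉K = refl
∣[]≔∣ (inside ∷ K)  (suc v) v∉K = cong suc (∣[]≔∣ K v (v∉K ∘ there))
∣[]≔∣ (outside ∷ K) (suc v) v∉K = ∣[]≔∣ K v (v∉K ∘ there)

x∉p-x : (p : Subset n) (x : Fin n) → x ∉ p - x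
-- Only `suc` can occur: removing `zero` leaves `outside` in the first position, which rules out
-- `here`.
x∉p-x (s ∷ p) (suc x) (there x∈p-x) = x∉p-x p x x∈p-x

⊆- : ∀ {K B : Subset n} {v} → v ∉ K → K ⊆ B → K ⊆ B - v
⊆- v∉K K⊆B x∈K = x∈p∧x≢y⇒x∈p-y (K⊆B x∈K) (λ { refl → v∉K x∈K })

-- Neighbourhoods, induced subgraphs and cliques.

module _ (G : Graph n) where

  ∈N⇒Adj : ∀ {v u} → u ∈ N G v → Adj G v u
  ∈N⇒Adj {v} {u} u∈N
    -- Abstracting `Adj? G v u` in the equation as well turns it into `false ≡ true` in the `no`
    -- case, which therefore needs no clause.
    with Adj? G v u | trans (sym (lookup∘tabulate (λ w → does (Adj? G v w)) u)) ([]=⇒lookup u∈N)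
  ... | yes vu | _ = vu

  Adj⇒∈N : ∀ {v u} → Adj G v u → u ∈ N G v
  Adj⇒∈N {v} {u} vu = lookup⇒[]= u _ (trans (lookup∘tabulate _ u) (dec-true (Adj? G v u) vu))

  isClique-[]⁺ : ∀ {S K} → K ⊆ S → IsClique G K → IsClique (G [ S ]) K
  isClique-[]⁺ K⊆S (K⊆V , adj) =
    (λ x∈K → x∈p∩q⁺ (K⊆V x∈K , K⊆S x∈K)) ,
    (λ u w u∈K w∈K u≢w → K⊆S u∈K , K⊆S w∈K , adj u w u∈K w∈K u≢w)

  isClique-[]⁻ : ∀ {S K} → IsClique (G [ S ]) K → IsClique G K
  isClique-[]⁻ {S} (K⊆V∩S , adj) =
    p∩q⊆p (V G) S ∘ K⊆V∩S ,
    (λ u w u∈K w∈K u≢w → proj₂ (proj₂ (adj u w u∈K w∈K u≢w)))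

  -- The vertex `v` belongs to the enlarged clique and differs from every member of `K`, hence is
  -- adjacent to all of them.
  isClique-[]≔⁻ : ∀ {K v} → v ∉ K → IsClique G (K [ v ]≔ inside) → K ⊆ N G v × IsClique G K
  isClique-[]≔⁻ {K} {v} v∉K (K⊆V , adj) =
    (λ {x} x∈K → Adj⇒∈N (adj v x ([]≔-updates K v) (⊆-[]≔ K v x∈K) (λ { refl → v∉K x∈K }))) ,
    K⊆V ∘ ⊆-[]≔ K v ,
    (λ u w u∈K w∈K → adj u w (⊆-[]≔ K v u∈K) (⊆-[]≔ K v w∈K))

  -- Of two distinct vertices at most one is `v`; if one is, the other lies in `N G v`, and
  -- otherwise both lie in the clique `K`.
  isClique-[]≔⁺ : ∀ {K v} → v ∈ V G → K ⊆ N G v → IsClique G K → IsClique G (K [ v ]≔ inside)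
  isClique-[]≔⁺ {K} {v} v∈V K⊆N (K⊆V , adj) = []≔⊆ , adj′
    where
    []≔⊆ : K [ v ]≔ inside ⊆ V G
    []≔⊆ x∈ with ∈-[]≔ K v x∈
    ... | inj₁ refl = v∈V
    ... | inj₂ x∈K  = K⊆V x∈K
    adj′ : ∀ u w → u ∈ K [ v ]≔ inside → w ∈ K [ v ]≔ inside → u ≢ w → Adj G u w
    adj′ u w u∈ w∈ u≢w with ∈-[]≔ K v u∈ | ∈-[]≔ K v w∈
    ... | inj₁ refl | inj₁ refl = contradiction refl u≢w
    ... | inj₁ refl | inj₂ w∈K  = ∈N⇒Adj (K⊆N w∈K)
    ... | inj₂ u∈K  | inj₁ refl = symmetric G (∈N⇒Adj (K⊆N u∈K))
    ... | inj₂ u∈K  | inj₂ w∈K  = adj u w u∈K w∈K u≢w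

  -- The size of `K` occurs in the list whose maximum defines `ω`, since `subsets` lists every
  -- subset.
  ∣clique∣≤ω : ∀ {K} → IsClique G K → ∣ K ∣ ≤ ω G
  ∣clique∣≤ω {K} K-clique = All.lookup (xs≤max 0 _)
    (∈-map⁺ ∣_∣ (∈-filter⁺ (isClique? G) (∈-subsets K) K-clique))

  -- Names the predicate filtered by `cliqueCount`, so that `cliqueCount G B i` is definitionally
  -- `count (isRestrictedClique? G B i)`.
  IsRestrictedClique : Subset n → ℕ → Pred (Subset n) 0ℓ
  IsRestrictedClique B i K = K ⊆ B × ∣ K ∣ ≡ i × IsClique G K

  isRestrictedClique? : ∀ B i → Decidable (IsRestrictedClique B i)
  isRestrictedClique? B i K = (K ⊆? B) ×-dec (∣ K ∣ ≟ i) ×-dec isClique? G K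

coeff-cliquePoly : (G : Graph n) (B : Subset n) → ∀ i → coeff (cliquePoly B G) i ≡ cliqueCount G B i
-- The list length is `suc (ω (G [ B ]))`, so an index outside it strictly exceeds `ω (G [ B ])`.
coeff-cliquePoly G B = coeff-applyUpTo (cliqueCount G B) _ λ i ω<i →
  count-none (isRestrictedClique? G B i) λ { (K⊆B , refl , K-clique) →
    ≤⇒≯ (∣clique∣≤ω (G [ B ]) (isClique-[]⁺ G K⊆B K-clique)) ω<i }

-- Recurrences for the clique counts.

module _ (G : Graph n) (v : Fin n) where

  -- A clique avoiding `v` lies in `V G - v`. Keeping `B′` general serves both cases of the theorem:
  -- it becomes `B - v` in one and `B` itself in the other.
  isRestrictedClique-∖ᵛ : ∀ {B B′ i K} → v ∉ K → B′ ⊆ B → (K ⊆ B → K ⊆ B′) →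
    IsRestrictedClique G B i K ⇔ IsRestrictedClique (G ∖ᵛ v) B′ i K
  isRestrictedClique-∖ᵛ v∉K B′⊆B restrict = mk⇔
    (λ (K⊆B , size , K-clique) → restrict K⊆B , size , isClique-[]⁺ G (⊆- v∉K (proj₁ K-clique)) K-clique)
    (λ (K⊆B′ , size , K-clique) → B′⊆B ∘ K⊆B′ , size , isClique-[]⁻ G K-clique)

  -- Because `v ∈ B`, adding `v` to a subset of `B` stays within `B`; the neighbourhood condition
  -- comes from the clique lemmas above.
  isRestrictedClique-N : ∀ {B i K} → v ∈ V G → v ∈ B → v ∉ K →
    IsRestrictedClique G B (suc i) (K [ v ]≔ inside) ⇔ IsRestrictedClique (G [ N G v ]) (B ∩ N G v) i K
  isRestrictedClique-N {B} {i} {K} v∈V v∈B v∉K = mk⇔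
    (λ (⊆B , size , clique) →
      let K⊆N , K-clique = isClique-[]≔⁻ G v∉K clique in
      (λ x∈K → x∈p∩q⁺ (⊆B (⊆-[]≔ K v x∈K) , K⊆N x∈K)) ,
      suc-injective (trans (sym (∣[]≔∣ K v v∉K)) size) ,
      isClique-[]⁺ G K⊆N K-clique)
    (λ (K⊆B∩N , size , K-clique) →
      (λ x∈ → case-∈ K⊆B∩N (∈-[]≔ K v x∈)) ,
      trans (∣[]≔∣ K v v∉K) (cong suc size) ,
      isClique-[]≔⁺ G v∈V (p∩q⊆q B (N G v) ∘ K⊆B∩N) (isClique-[]⁻ G K-clique))
    where
    case-∈ : ∀ {x} → K ⊆ B ∩ N G v → x ≡ v ⊎ x ∈ K → x ∈ B
    case-∈ K⊆ (inj₁ refl) = v∈B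
    case-∈ K⊆ (inj₂ x∈K)  = p∩q⊆p B (N G v) (K⊆ x∈K)

  cliqueCount-zero : ∀ B → cliqueCount G B 0 ≡ cliqueCount (G ∖ᵛ v) (B - v) 0
  cliqueCount-zero B = count-cong (isRestrictedClique? G B 0) (isRestrictedClique? (G ∖ᵛ v) (B - v) 0) (mk⇔
    (λ k@(_ , size , _) → to (equiv size) k) (λ k@(_ , size , _) → from (equiv size) k))
    where
    empty : ∀ {K : Subset n} → ∣ K ∣ ≡ 0 → v ∉ K
    -- If `v` were in `K`, then `K - v` would have fewer than 0 elements.
    empty {K} size v∈K = n≮0 (subst (∣ K - v ∣ <_) size (x∈p⇒∣p-x∣<∣p∣ v∈K))
    equiv : ∀ {K} → ∣ K ∣ ≡ 0 → IsRestrictedClique G B 0 K ⇔ IsRestrictedClique (G ∖ᵛ v) (B - v) 0 K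
    equiv size = isRestrictedClique-∖ᵛ (empty size) (p─q⊆p B _) (⊆- (empty size))

  cliqueCount-suc : ∀ {B} → v ∈ V G → v ∈ B → ∀ i →
    cliqueCount G B (suc i) ≡
      cliqueCount (G ∖ᵛ v) (B - v) (suc i) + cliqueCount (G [ N G v ]) (B ∩ N G v) i
  cliqueCount-suc {B} v∈V v∈B i = count-split v
    (isRestrictedClique? G B (suc i))
    (isRestrictedClique? (G ∖ᵛ v) (B - v) (suc i))
    (isRestrictedClique? (G [ N G v ]) (B ∩ N G v) i)
    (λ (K⊆B-v , _) → x∉p-x B v ∘ K⊆B-v)
    (λ v∉K → isRestrictedClique-∖ᵛ v∉K (p─q⊆p B _) (⊆- v∉K))
    -- No vertex is its own neighbour, so subsets of `N G v` avoid `v`.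
    (λ (K⊆B∩N , _) v∈K → irreflexive G (∈N⇒Adj G (p∩q⊆q B (N G v) (K⊆B∩N v∈K))))
    (isRestrictedClique-N v∈V v∈B)

  -- Every subset of `B` already avoids `v`, so deleting `v` affects none of the counted cliques.
  cliqueCount-∉ : ∀ {B} → v ∉ B → ∀ i → cliqueCount G B i ≡ cliqueCount (G ∖ᵛ v) B i
  cliqueCount-∉ {B} v∉B i = count-cong (isRestrictedClique? G B i) (isRestrictedClique? (G ∖ᵛ v) B i) (mk⇔
    (λ k@(K⊆B , _) → to (equiv K⊆B) k) (λ k@(K⊆B , _) → from (equiv K⊆B) k))
    where
    equiv : ∀ {K} → K ⊆ B → IsRestrictedClique G B i K ⇔ IsRestrictedClique (G ∖ᵛ v) B i K
    equiv K⊆B = isRestrictedClique-∖ᵛ (v∉B ∘ K⊆B) (λ x∈B → x∈B) (λ K⊆B → K⊆B)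

lemma2p1 : ∀ (n : ℕ) (G : Graph n) (v : Fin n) → v ∈ V G →
    ∀ (B : Subset n) → B ⊆ V G →
    (v ∈ B →
    cliquePoly B G
    ≈ₚ cliquePoly (B - v) (G ∖ᵛ v) +ₚ X *ₚ cliquePoly (B ∩ N G v) (G [ N G v ]))
    × (v ∉ B → cliquePoly B G ≈ₚ cliquePoly B (G ∖ᵛ v))
lemma2p1 n G v v∈V B _ = part-i , part-ii
  where
  open ≡-Reasoning

  p q : Poly
  p = cliquePoly (B - v) (G ∖ᵛ v)
  q = cliquePoly (B ∩ N G v) (G [ N G v ])

  part-i : v ∈ B → cliquePoly B G ≈ₚ p +ₚ X *ₚ q
  -- The degree is split because multiplication by `X` contributes nothing in degree 0 and shifts
  -- all other coefficients by one.
  part-i v∈B zero = begin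
    coeff (cliquePoly B G) 0               ≡⟨ coeff-cliquePoly G B 0 ⟩
    cliqueCount G B 0                      ≡⟨ cliqueCount-zero G v B ⟩
    cliqueCount (G ∖ᵛ v) (B - v) 0         ≡⟨ coeff-cliquePoly (G ∖ᵛ v) (B - v) 0 ⟨
    coeff p 0                              ≡⟨ +-identityʳ _ ⟨
    coeff p 0 + 0                          ≡⟨ cong (coeff p 0 +_) (coeff-X*ₚ-zero q) ⟨
    coeff p 0 + coeff (X *ₚ q) 0           ≡⟨ coeff-+ₚ p (X *ₚ q) 0 ⟨
    coeff (p +ₚ X *ₚ q) 0                  ∎
  part-i v∈B (suc i) = begin
    coeff (cliquePoly B G) (suc i)         ≡⟨ coeff-cliquePoly G B (suc i) ⟩
    cliqueCount G B (suc i)                ≡⟨ cliqueCount-suc G v v∈V v∈B i ⟩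
    cliqueCount (G ∖ᵛ v) (B - v) (suc i) + cliqueCount (G [ N G v ]) (B ∩ N G v) i
      ≡⟨ cong₂ _+_ (coeff-cliquePoly (G ∖ᵛ v) (B - v) (suc i))
                   (trans (coeff-X*ₚ-suc q i) (coeff-cliquePoly (G [ N G v ]) (B ∩ N G v) i)) ⟨
    coeff p (suc i) + coeff (X *ₚ q) (suc i) ≡⟨ coeff-+ₚ p (X *ₚ q) (suc i) ⟨
    coeff (p +ₚ X *ₚ q) (suc i)            ∎

  part-ii : v ∉ B → cliquePoly B G ≈ₚ cliquePoly B (G ∖ᵛ v)
  part-ii v∉B i = begin
    coeff (cliquePoly B G) i               ≡⟨ coeff-cliquePoly G B i ⟩
    cliqueCount G B i                      ≡⟨ cliqueCount-∉ G v v∉B i ⟩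
    cliqueCount (G ∖ᵛ v) B i               ≡⟨ coeff-cliquePoly (G ∖ᵛ v) B i ⟨
    coeff (cliquePoly B (G ∖ᵛ v)) i        ∎
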